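{- Let $(X,\|\cdot\|)$ be a separable Banach lattice and let $f:X\to X$ be a contraction with constant $k\in(0,1)$, i.e. $\|f(x)-f(y)\|\le k\|x-y\|$ for all $x,y\in X$. Let $[B_r]$ denote the set of all closed balls $[x,r]$ with centre $x\in X$ and radius $r\ge 0$, and define $T:[B_r]\to[B_r]$ by $T([x,r])=[f(x),kr]$. Then $T$ has a unique fixed point. Moreover, for any given $x\in X$, the iterates $f^n(x)$ converge to the fixed point of $T$; that is, the fixed point has the form $[x^*,0]$ with $x^*\in X$, and $\|f^n(x)-x^*\|\to 0$ as $n\to\infty$ for every $x\in X$.
   Context: A Banach lattice is a real Banach space that is also a vector lattice, with $|x|=x\vee(-x)$, such that $|x|\le|y|$ implies $\|x\|\le\|y\|$. The symbol $[x,r]$ denotes the closed ball $\overline{B}_r(x)=\{y\in X:\|x-y\|\le r\}$, regarded as the pair consisting of its centre $x\in X$ and its radius $r\ge 0$ (radius $0$ is allowed); two elements $[x,r]$ and $[y,s]$ are equal iff $x=y$ and $r=s$. A fixed point of $T$ is an element $[x,r]$ with $T([x,r])=[x,r]$. A sequence $[x_n,r_n]$ converges to $[x,r]$ if $\|x_n-x\|\to 0$ and $r_n\to r$. $f^n$ denotes the $n$-fold composition of $f$ with itself. -}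

module Defs where

open import Algebra.Bundles using (CommutativeRing)
open import Algebra.Module.Bundles using (LeftModule)
open import Data.Nat.Base as ℕ using (ℕ; _⊔_)
import Data.Nat.Properties as ℕ
open import Data.Product.Base using (Σ-syntax; ∃; _×_; _,_)
open import Data.Rational.Base as ℚ using (ℚ; 0ℚ; 1ℚ; ½; _+_; _*_; -_; _-_; _<_; _≤_; ∣_∣)
import Data.Rational.Properties as ℚ
open import Data.Rational.Solver using (module +-*-Solver)
open import Data.Sum.Base using (inj₁; inj₂)
open import Level using (0ℓ) renaming (_⊔_ to _⊔ˡ_; suc to lsuc)
open import Relation.Binary.Core using (Rel)
open import Relation.Binary.Lattice.Structures using (IsLattice)
open import Relation.Binary.PropositionalEquality
  using (_≡_; refl; sym; trans; cong; subst)

------------------------------------------------------------------------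
-- Auxiliary facts about ℚ

open +-*-Solver using (solve; _:=_; _:+_; _:*_; :-_; _:-_)

module ℚ-Lemmas where
  abstract
    half⁺ : ∀ {ε} → 0ℚ < ε → 0ℚ < ε * ½
    half⁺ {ε} 0<ε = subst (_< ε * ½) (ℚ.*-zeroˡ ½) (ℚ.*-monoˡ-<-pos ½ 0<ε)

    half+half : ∀ ε → ε * ½ + ε * ½ ≡ ε
    half+half ε = trans (sym (ℚ.*-distribˡ-+ ε ½ ½)) (ℚ.*-identityʳ ε)

    pos*pos : ∀ {p q} → 0ℚ < p → 0ℚ < q → 0ℚ < p * q
    pos*pos {p} {q} 0<p 0<q =
      subst (_< p * q) (ℚ.*-zeroˡ q) (ℚ.*-monoˡ-<-pos q {{ℚ.positive 0<q}} 0<p)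

    quotient : ∀ {ε C} → 0ℚ < ε → 0ℚ < C → Σ[ δ ∈ ℚ ] 0ℚ < δ × C * δ ≡ ε
    quotient {ε} {C} 0<ε 0<C =
      ε * ℚ.1/ C , pos*pos 0<ε (ℚ.positive⁻¹ (ℚ.1/ C) {{ℚ.1/pos⇒pos C}}) , C*δ≡ε
      where
      instance
        C-pos : ℚ.Positive C
        C-pos = ℚ.positive 0<C
        C-nonZero : ℚ.NonZero C
        C-nonZero = ℚ.pos⇒nonZero C
      C*δ≡ε : C * (ε * ℚ.1/ C) ≡ ε
      C*δ≡ε = trans (solve 3 (λ c e i → c :* (e :* i) := e :* (c :* i)) refl C ε (ℚ.1/ C))
                    (trans (cong (ε *_) (ℚ.*-inverseʳ C)) (ℚ.*-identityʳ ε))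

    ∣*∣-bound : ∀ {a b A δ} → 0ℚ < A → ∣ a ∣ < A → ∣ b ∣ < δ → ∣ a * b ∣ < A * δ
    ∣*∣-bound {a} {b} {A} {δ} 0<A a<A b<δ = begin-strict
      ∣ a * b ∣       ≡⟨ ℚ.∣p*q∣≡∣p∣*∣q∣ a b ⟩
      ∣ a ∣ * ∣ b ∣   ≤⟨ ℚ.*-monoʳ-≤-nonNeg ∣ b ∣ {{ℚ.∣-∣-nonNeg b}} (ℚ.<⇒≤ a<A) ⟩
      A * ∣ b ∣       <⟨ ℚ.*-monoʳ-<-pos A {{ℚ.positive 0<A}} b<δ ⟩
      A * δ           ∎
      where open ℚ.≤-Reasoning

    ∣+∣-half : ∀ {a b ε} → ∣ a ∣ < ε * ½ → ∣ b ∣ < ε * ½ → ∣ a + b ∣ < ε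
    ∣+∣-half {a} {b} {ε} a< b< = begin-strict
      ∣ a + b ∣        ≤⟨ ℚ.∣p+q∣≤∣p∣+∣q∣ a b ⟩
      ∣ a ∣ + ∣ b ∣    <⟨ ℚ.+-mono-< a< b< ⟩
      ε * ½ + ε * ½    ≡⟨ half+half ε ⟩
      ε                ∎
      where open ℚ.≤-Reasoning

    p≤∣p∣ : ∀ p → p ≤ ∣ p ∣
    p≤∣p∣ p with ℚ.≤-total 0ℚ p
    ... | inj₁ 0≤p = ℚ.≤-reflexive (sym (ℚ.0≤p⇒∣p∣≡p 0≤p))
    ... | inj₂ p≤0 = ℚ.≤-trans p≤0 (ℚ.0≤∣p∣ p)

    ∣p∣≤∣p-q∣+∣q∣ : ∀ p q → ∣ p ∣ ≤ ∣ p - q ∣ + ∣ q ∣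
    ∣p∣≤∣p-q∣+∣q∣ p q = begin
      ∣ p ∣              ≡⟨ cong ∣_∣ (solve 2 (λ p q → p := (p :- q) :+ q) refl p q) ⟩
      ∣ p - q + q ∣      ≤⟨ ℚ.∣p+q∣≤∣p∣+∣q∣ (p - q) q ⟩
      ∣ p - q ∣ + ∣ q ∣  ∎
      where open ℚ.≤-Reasoning

    ∣-∣-comm : ∀ p q → ∣ p - q ∣ ≡ ∣ q - p ∣
    ∣-∣-comm p q = trans (sym (ℚ.∣-p∣≡∣p∣ (p - q)))
      (cong ∣_∣ (solve 2 (λ p q → :- (p :- q) := q :- p) refl p q))

    ∣p∣-∣q∣≤∣p-q∣ : ∀ p q → ∣ p ∣ - ∣ q ∣ ≤ ∣ p - q ∣
    ∣p∣-∣q∣≤∣p-q∣ p q = begin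
      ∣ p ∣ - ∣ q ∣                ≤⟨ ℚ.+-monoˡ-≤ (- ∣ q ∣) (∣p∣≤∣p-q∣+∣q∣ p q) ⟩
      ∣ p - q ∣ + ∣ q ∣ - ∣ q ∣    ≡⟨ solve 2 (λ a b → a :+ b :- b := a) refl ∣ p - q ∣ ∣ q ∣ ⟩
      ∣ p - q ∣                    ∎
      where open ℚ.≤-Reasoning

    ∣∣p∣-∣q∣∣≤∣p-q∣ : ∀ p q → ∣ ∣ p ∣ - ∣ q ∣ ∣ ≤ ∣ p - q ∣
    ∣∣p∣-∣q∣∣≤∣p-q∣ p q with ℚ.∣p∣≡p∨∣p∣≡-p (∣ p ∣ - ∣ q ∣)
    ... | inj₁ eq = ℚ.≤-trans (ℚ.≤-reflexive eq) (∣p∣-∣q∣≤∣p-q∣ p q)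
    ... | inj₂ eq = begin
      ∣ ∣ p ∣ - ∣ q ∣ ∣   ≡⟨ eq ⟩
      - (∣ p ∣ - ∣ q ∣)   ≡⟨ solve 2 (λ a b → :- (a :- b) := b :- a) refl ∣ p ∣ ∣ q ∣ ⟩
      ∣ q ∣ - ∣ p ∣       ≤⟨ ∣p∣-∣q∣≤∣p-q∣ q p ⟩
      ∣ q - p ∣           ≡⟨ ∣-∣-comm q p ⟩
      ∣ p - q ∣           ∎
      where open ℚ.≤-Reasoning

open ℚ-Lemmas

------------------------------------------------------------------------
-- Sequences of rationals

Eventually : ∀ {p} → (ℕ → Set p) → Set p
Eventually P = Σ[ N ∈ ℕ ] ∀ n → N ℕ.≤ n → P n

IsCauchyℚ : (ℕ → ℚ) → Set
IsCauchyℚ s = ∀ ε → 0ℚ < ε →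
  Σ[ N ∈ ℕ ] ∀ m n → N ℕ.≤ m → N ℕ.≤ n → ∣ s m - s n ∣ < ε

IsNull : (ℕ → ℚ) → Set
IsNull s = ∀ ε → 0ℚ < ε → Eventually λ n → ∣ s n ∣ < ε

module CauchyLemmas where
  abstract
    map₂-ev : ∀ {p q r} {P : ℕ → Set p} {Q : ℕ → Set q} {R : ℕ → Set r} →
              (∀ n → P n → Q n → R n) → Eventually P → Eventually Q → Eventually R
    map₂-ev f (M , P) (N , Q) = M ⊔ N , λ n le →
      f n (P n (ℕ.≤-trans (ℕ.m≤m⊔n M N) le)) (Q n (ℕ.≤-trans (ℕ.m≤n⊔m M N) le))

    bounded : ∀ {s} → IsCauchyℚ s → Σ[ B ∈ ℚ ] 0ℚ < B × Eventually λ n → ∣ s n ∣ < B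
    bounded {s} c with c 1ℚ (ℚ.positive⁻¹ 1ℚ)
    ... | N , close = 1ℚ + ∣ s N ∣
      , ℚ.<-≤-trans (ℚ.positive⁻¹ 1ℚ)
          (subst (_≤ 1ℚ + ∣ s N ∣) (ℚ.+-identityʳ 1ℚ) (ℚ.+-monoʳ-≤ 1ℚ (ℚ.0≤∣p∣ (s N))))
      , N , λ n le → ℚ.≤-<-trans (∣p∣≤∣p-q∣+∣q∣ (s n) (s N))
                       (ℚ.+-monoˡ-< ∣ s N ∣ (close n N le ℕ.≤-refl))

    const-cauchy : ∀ q → IsCauchyℚ (λ _ → q)
    const-cauchy q ε 0<ε = 0 , λ _ _ _ _ →
      subst (_< ε) (sym (cong ∣_∣ (ℚ.+-inverseʳ q))) 0<ε

    +-cauchy : ∀ {s t} → IsCauchyℚ s → IsCauchyℚ t → IsCauchyℚ (λ n → s n + t n)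
    +-cauchy {s} {t} cs ct ε 0<ε with cs (ε * ½) (half⁺ 0<ε) | ct (ε * ½) (half⁺ 0<ε)
    ... | M , P | N , Q = M ⊔ N , λ m n lm ln →
      subst (λ z → ∣ z ∣ < ε)
        (solve 4 (λ a b c d → (a :- b) :+ (c :- d) := (a :+ c) :- (b :+ d)) refl
           (s m) (s n) (t m) (t n))
        (∣+∣-half
          (P m n (ℕ.≤-trans (ℕ.m≤m⊔n M N) lm) (ℕ.≤-trans (ℕ.m≤m⊔n M N) ln))
          (Q m n (ℕ.≤-trans (ℕ.m≤n⊔m M N) lm) (ℕ.≤-trans (ℕ.m≤n⊔m M N) ln)))

    neg-cauchy : ∀ {s} → IsCauchyℚ s → IsCauchyℚ (λ n → - s n)
    neg-cauchy {s} cs ε 0<ε with cs ε 0<ε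
    ... | N , P = N , λ m n lm ln →
      subst (_< ε) (cong ∣_∣ (solve 2 (λ a b → b :- a := (:- a) :- (:- b)) refl (s m) (s n)))
        (P n m ln lm)

    abs-cauchy : ∀ {s} → IsCauchyℚ s → IsCauchyℚ (λ n → ∣ s n ∣)
    abs-cauchy {s} cs ε 0<ε with cs ε 0<ε
    ... | N , P = N , λ m n lm ln → ℚ.≤-<-trans (∣∣p∣-∣q∣∣≤∣p-q∣ (s m) (s n)) (P m n lm ln)

    -- ∣a b - a' b'∣ < ε when ∣a∣ < A, ∣b'∣ < B, A ∣b - b'∣ < ε/2 and B ∣a - a'∣ < ε/2
    *-close : ∀ {a b a' b' A B δ₁ δ₂} ε → 0ℚ < A → 0ℚ < B → A * δ₁ ≡ ε * ½ → B * δ₂ ≡ ε * ½ →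
              ∣ a ∣ < A → ∣ b' ∣ < B → ∣ b - b' ∣ < δ₁ → ∣ a - a' ∣ < δ₂ →
              ∣ a * b - a' * b' ∣ < ε
    *-close {a} {b} {a'} {b'} ε 0<A 0<B e₁ e₂ a< b'< db da =
      subst (λ z → ∣ z ∣ < ε)
        (solve 4 (λ a b a' b' → a :* (b :- b') :+ b' :* (a :- a') := a :* b :- a' :* b') refl
           a b a' b')
        (∣+∣-half (subst (∣ a * (b - b') ∣ <_) e₁ (∣*∣-bound {a} 0<A a< db))
                  (subst (∣ b' * (a - a') ∣ <_) e₂ (∣*∣-bound {b'} 0<B b'< da)))

    *-cauchy : ∀ {s t} → IsCauchyℚ s → IsCauchyℚ t → IsCauchyℚ (λ n → s n * t n)
    *-cauchy {s} {t} cs ct ε 0<ε =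
      let A , 0<A , K , bs  = bounded cs
          B , 0<B , L , bt  = bounded ct
          δ₁ , 0<δ₁ , e₁    = quotient (half⁺ 0<ε) 0<A
          δ₂ , 0<δ₂ , e₂    = quotient (half⁺ 0<ε) 0<B
          M , P             = ct δ₁ 0<δ₁
          N , Q             = cs δ₂ 0<δ₂
          KL≤               = ℕ.m≤m⊔n (K ⊔ L) (M ⊔ N)
          MN≤               = ℕ.m≤n⊔m (K ⊔ L) (M ⊔ N)
          K≤                = ℕ.≤-trans (ℕ.m≤m⊔n K L) KL≤
          L≤                = ℕ.≤-trans (ℕ.m≤n⊔m K L) KL≤
          M≤                = ℕ.≤-trans (ℕ.m≤m⊔n M N) MN≤
          N≤                = ℕ.≤-trans (ℕ.m≤n⊔m M N) MN≤
      in (K ⊔ L) ⊔ (M ⊔ N) , λ m n lm ln →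
        *-close {s m} {t m} {s n} {t n} ε 0<A 0<B e₁ e₂
          (bs m (ℕ.≤-trans K≤ lm)) (bt n (ℕ.≤-trans L≤ ln))
          (P m n (ℕ.≤-trans M≤ lm) (ℕ.≤-trans M≤ ln))
          (Q m n (ℕ.≤-trans N≤ lm) (ℕ.≤-trans N≤ ln))

open CauchyLemmas

------------------------------------------------------------------------
-- The real numbers: Cauchy sequences of rationals, with equality given by
-- the setoid relation _≈ᴿ_.  In the type theory, the existence of N for each ε
-- in IsCauchyℚ provides a modulus of convergence.

record ℝ : Set where
  constructor mkℝ
  field
    seq    : ℕ → ℚ
    cauchy : IsCauchyℚ seq

open ℝ public

infix 4 _≈ᴿ_ _≤ᴿ_ _<ᴿ_

-- The relations are records, rather than plain definitions, so that their
-- endpoints can be inferred.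
record _≈ᴿ_ (x y : ℝ) : Set where
  constructor mk≈
  field null : IsNull λ n → seq x n - seq y n

record _≤ᴿ_ (x y : ℝ) : Set where
  constructor mk≤
  field le : ∀ ε → 0ℚ < ε → Eventually λ n → seq x n < seq y n + ε

record _<ᴿ_ (x y : ℝ) : Set where
  constructor mk<
  field lt : Σ[ ε ∈ ℚ ] 0ℚ < ε × Eventually λ n → seq x n + ε < seq y n

infixl 6 _+ᴿ_
infixl 7 _*ᴿ_
infix  8 -ᴿ_

0ᴿ 1ᴿ : ℝ
0ᴿ = mkℝ (λ _ → 0ℚ) (const-cauchy 0ℚ)
1ᴿ = mkℝ (λ _ → 1ℚ) (const-cauchy 1ℚ)

_+ᴿ_ _*ᴿ_ : ℝ → ℝ → ℝ
x +ᴿ y = mkℝ (λ n → seq x n + seq y n) (+-cauchy {seq x} {seq y} (cauchy x) (cauchy y))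
x *ᴿ y = mkℝ (λ n → seq x n * seq y n) (*-cauchy {seq x} {seq y} (cauchy x) (cauchy y))

-ᴿ_ ∣_∣ᴿ : ℝ → ℝ
-ᴿ x   = mkℝ (λ n → - seq x n) (neg-cauchy {seq x} (cauchy x))
∣ x ∣ᴿ = mkℝ (λ n → ∣ seq x n ∣) (abs-cauchy {seq x} (cauchy x))

private
  abstract
    pointwise : ∀ {x y} → (∀ n → seq x n ≡ seq y n) → x ≈ᴿ y
    pointwise {x} {y} eq = mk≈ λ ε 0<ε → 0 , λ n _ →
      subst (_< ε)
        (sym (cong ∣_∣ (trans (cong (_- seq y n) (eq n)) (ℚ.+-inverseʳ (seq y n))))) 0<ε

    ≈-sym : ∀ {x y} → x ≈ᴿ y → y ≈ᴿ x
    ≈-sym {x} {y} (mk≈ p) = mk≈ λ ε 0<ε → let N , P = p ε 0<ε in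
      N , λ n le → subst (_< ε) (∣-∣-comm (seq x n) (seq y n)) (P n le)

    ≈-trans : ∀ {x y z} → x ≈ᴿ y → y ≈ᴿ z → x ≈ᴿ z
    ≈-trans {x} {y} {z} (mk≈ p) (mk≈ q) = mk≈ λ ε 0<ε →
      map₂-ev (λ n a b → subst (λ w → ∣ w ∣ < ε)
          (solve 3 (λ x y z → (x :- y) :+ (y :- z) := x :- z) refl (seq x n) (seq y n) (seq z n))
          (∣+∣-half a b))
        (p (ε * ½) (half⁺ 0<ε)) (q (ε * ½) (half⁺ 0<ε))

    +-cong : ∀ {x y u v} → x ≈ᴿ y → u ≈ᴿ v → x +ᴿ u ≈ᴿ y +ᴿ v
    +-cong {x} {y} {u} {v} (mk≈ p) (mk≈ q) = mk≈ λ ε 0<ε →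
      map₂-ev (λ n a b → subst (λ w → ∣ w ∣ < ε)
          (solve 4 (λ x y u v → (x :- y) :+ (u :- v) := (x :+ u) :- (y :+ v)) refl
            (seq x n) (seq y n) (seq u n) (seq v n))
          (∣+∣-half a b))
        (p (ε * ½) (half⁺ 0<ε)) (q (ε * ½) (half⁺ 0<ε))

    neg-cong : ∀ {x y} → x ≈ᴿ y → -ᴿ x ≈ᴿ -ᴿ y
    neg-cong {x} {y} x≈y = let mk≈ p = ≈-sym x≈y in mk≈ λ ε 0<ε → let N , P = p ε 0<ε in
      N , λ n le → subst (_< ε)
        (cong ∣_∣ (solve 2 (λ a b → b :- a := (:- a) :- (:- b)) refl (seq x n) (seq y n)))
        (P n le)

    *-cong : ∀ {x y u v} → x ≈ᴿ y → u ≈ᴿ v → x *ᴿ u ≈ᴿ y *ᴿ v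
    *-cong {x} {y} {u} {v} (mk≈ p) (mk≈ q) = mk≈ λ ε 0<ε →
      let A , 0<A , bx    = bounded (cauchy x)
          B , 0<B , bv    = bounded (cauchy v)
          δ₁ , 0<δ₁ , e₁  = quotient (half⁺ 0<ε) 0<A
          δ₂ , 0<δ₂ , e₂  = quotient (half⁺ 0<ε) 0<B
      in map₂-ev (λ n (a , b) (c , d) →
             *-close {seq x n} {seq u n} {seq y n} {seq v n} ε 0<A 0<B e₁ e₂ a b c d)
           (map₂-ev (λ _ → _,_) bx bv)
           (map₂-ev (λ _ → _,_) (q δ₁ 0<δ₁) (p δ₂ 0<δ₂))

ℝ-commutativeRing : CommutativeRing 0ℓ 0ℓ
ℝ-commutativeRing = record
  { Carrier = ℝ
  ; _≈_ = _≈ᴿ_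
  ; _+_ = _+ᴿ_
  ; _*_ = _*ᴿ_
  ; -_ = -ᴿ_
  ; 0# = 0ᴿ
  ; 1# = 1ᴿ
  ; isCommutativeRing = record
    { isRing = record
      { +-isAbelianGroup = record
        { isGroup = record
          { isMonoid = record
            { isSemigroup = record
              { isMagma = record
                { isEquivalence = record
                  { refl = pointwise λ _ → refl ; sym = ≈-sym ; trans = ≈-trans }
                ; ∙-cong = +-cong
                }
              ; assoc = λ x y z → pointwise λ n → ℚ.+-assoc (seq x n) (seq y n) (seq z n)
              }
            ; identity = (λ x → pointwise λ n → ℚ.+-identityˡ (seq x n))
                       , (λ x → pointwise λ n → ℚ.+-identityʳ (seq x n))
            }
          ; inverse = (λ x → pointwise λ n → ℚ.+-inverseˡ (seq x n))
                    , (λ x → pointwise λ n → ℚ.+-inverseʳ (seq x n))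
          ; ⁻¹-cong = neg-cong
          }
        ; comm = λ x y → pointwise λ n → ℚ.+-comm (seq x n) (seq y n)
        }
      ; *-cong = *-cong
      ; *-assoc = λ x y z → pointwise λ n → ℚ.*-assoc (seq x n) (seq y n) (seq z n)
      ; *-identity = (λ x → pointwise λ n → ℚ.*-identityˡ (seq x n))
                   , (λ x → pointwise λ n → ℚ.*-identityʳ (seq x n))
      ; distrib = (λ x y z → pointwise λ n → ℚ.*-distribˡ-+ (seq x n) (seq y n) (seq z n))
                , (λ x y z → pointwise λ n → ℚ.*-distribʳ-+ (seq x n) (seq y n) (seq z n))
      }
    ; *-comm = λ x y → pointwise λ n → ℚ.*-comm (seq x n) (seq y n)
    }
  }

≤ᴿ-refl : ∀ {x} → x ≤ᴿ x
≤ᴿ-refl {x} = mk≤ λ ε 0<ε → 0 , λ n _ →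
  subst (_< seq x n + ε) (ℚ.+-identityʳ (seq x n)) (ℚ.+-monoʳ-< (seq x n) 0<ε)

<ᴿ⇒≤ᴿ : ∀ {x y} → x <ᴿ y → x ≤ᴿ y
<ᴿ⇒≤ᴿ {x} {y} (mk< (δ , 0<δ , N , P)) = mk≤ λ ε 0<ε → N , λ n le →
  ℚ.<-trans
    (subst (_< seq x n + δ) (ℚ.+-identityʳ (seq x n)) (ℚ.+-monoʳ-< (seq x n) 0<δ))
    (ℚ.<-trans (P n le)
      (subst (_< seq y n + ε) (ℚ.+-identityʳ (seq y n)) (ℚ.+-monoʳ-< (seq y n) 0<ε)))

private
  abstract
    -- If a, b > -δ then 0 < (a + δ)(b + δ) = ab + δ(a + b + δ).
    product-bound : ∀ {a b A B δ} ε → 0ℚ < δ → δ < 1ℚ → (A + B + 1ℚ + ε) * δ ≡ ε → 0ℚ < ε →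
                    0ℚ < a + δ → 0ℚ < b + δ → ∣ a ∣ < A → ∣ b ∣ < B → 0ℚ < a * b + ε
    product-bound {a} {b} {A} {B} {δ} ε 0<δ δ<1 e 0<ε a> b> a< b< = begin-strict
      0ℚ                                <⟨ pos*pos a> b> ⟩
      (a + δ) * (b + δ)                 ≡⟨ solve 3 (λ a b d → (a :+ d) :* (b :+ d)
                                              := a :* b :+ (a :+ b :+ d) :* d) refl a b δ ⟩
      a * b + (a + b + δ) * δ           <⟨ ℚ.+-monoʳ-< (a * b)
                                             (ℚ.*-monoˡ-<-pos δ {{ℚ.positive 0<δ}} sum<) ⟩
      a * b + (A + B + 1ℚ + ε) * δ      ≡⟨ cong (a * b +_) e ⟩
      a * b + ε                         ∎
      where
      open ℚ.≤-Reasoning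
      sum< : a + b + δ < A + B + 1ℚ + ε
      sum< = begin-strict
        a + b + δ          <⟨ ℚ.+-mono-< (ℚ.+-mono-< (ℚ.≤-<-trans (p≤∣p∣ a) a<)
                                                     (ℚ.≤-<-trans (p≤∣p∣ b) b<)) δ<1 ⟩
        A + B + 1ℚ         ≡⟨ sym (ℚ.+-identityʳ (A + B + 1ℚ)) ⟩
        A + B + 1ℚ + 0ℚ    <⟨ ℚ.+-monoʳ-< (A + B + 1ℚ) 0<ε ⟩
        A + B + 1ℚ + ε     ∎

0≤x*y : ∀ {x y} → 0ᴿ ≤ᴿ x → 0ᴿ ≤ᴿ y → 0ᴿ ≤ᴿ x *ᴿ y
0≤x*y {x} {y} (mk≤ p) (mk≤ q) = mk≤ λ ε 0<ε →
  let A , 0<A , bx  = bounded (cauchy x)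
      B , 0<B , by  = bounded (cauchy y)
      0<A+B+1       = ℚ.+-mono-< (ℚ.+-mono-< 0<A 0<B) (ℚ.positive⁻¹ 1ℚ)
      C             = A + B + 1ℚ + ε
      0<C           = ℚ.+-mono-< 0<A+B+1 0<ε
      δ , 0<δ , e   = quotient 0<ε 0<C
      ε<C           = subst (_< C) (ℚ.+-identityˡ ε) (ℚ.+-monoˡ-< ε 0<A+B+1)
      δ<1           = ℚ.*-cancelˡ-<-nonNeg C {{ℚ.nonNegative (ℚ.<⇒≤ 0<C)}}
                        (subst (C * δ <_) (sym (ℚ.*-identityʳ C)) (subst (_< C) (sym e) ε<C))
  in map₂-ev (λ n (a> , b>) (a< , b<) →
         product-bound {seq x n} {seq y n} ε 0<δ δ<1 e 0<ε a> b> a< b<)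
       (map₂-ev (λ _ → _,_) (p δ 0<δ) (q δ 0<δ))
       (map₂-ev (λ _ → _,_) bx by)

------------------------------------------------------------------------
-- Banach lattices

record VectorLattice c ℓ ℓ₂ : Set (lsuc (c ⊔ˡ ℓ ⊔ˡ ℓ₂)) where
  field
    leftModule : LeftModule (CommutativeRing.ring ℝ-commutativeRing) c ℓ

  open LeftModule leftModule public

  infix 4 _≤ᴹ_
  infixr 6 _∨_
  infixr 7 _∧_

  field
    _≤ᴹ_      : Rel Carrierᴹ ℓ₂
    _∨_ _∧_   : Carrierᴹ → Carrierᴹ → Carrierᴹ
    isLattice : IsLattice _≈ᴹ_ _≤ᴹ_ _∨_ _∧_
    +ᴹ-monoˡ-≤ : ∀ {x y} z → x ≤ᴹ y → x +ᴹ z ≤ᴹ y +ᴹ z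
    *ₗ-nonNeg  : ∀ {a x} → 0ᴿ ≤ᴿ a → 0ᴹ ≤ᴹ x → 0ᴹ ≤ᴹ a *ₗ x

  infixl 6 _-ᴹ_

  _-ᴹ_ : Carrierᴹ → Carrierᴹ → Carrierᴹ
  x -ᴹ y = x +ᴹ (-ᴹ y)

  ∣_∣ᴹ : Carrierᴹ → Carrierᴹ
  ∣ x ∣ᴹ = x ∨ (-ᴹ x)

record BanachLattice c ℓ ℓ₂ : Set (lsuc (c ⊔ˡ ℓ ⊔ˡ ℓ₂)) where
  field
    vectorLattice : VectorLattice c ℓ ℓ₂

  open VectorLattice vectorLattice public

  field
    ‖_‖            : Carrierᴹ → ℝ
    ‖‖-cong        : ∀ {x y} → x ≈ᴹ y → ‖ x ‖ ≈ᴿ ‖ y ‖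
    ‖‖-nonNeg      : ∀ x → 0ᴿ ≤ᴿ ‖ x ‖
    ‖‖-definite    : ∀ {x} → ‖ x ‖ ≈ᴿ 0ᴿ → x ≈ᴹ 0ᴹ
    ‖‖-homogeneous : ∀ a x → ‖ a *ₗ x ‖ ≈ᴿ ∣ a ∣ᴿ *ᴿ ‖ x ‖
    ‖‖-triangle    : ∀ x y → ‖ x +ᴹ y ‖ ≤ᴿ ‖ x ‖ +ᴿ ‖ y ‖
    ‖‖-mono        : ∀ {x y} → ∣ x ∣ᴹ ≤ᴹ ∣ y ∣ᴹ → ‖ x ‖ ≤ᴿ ‖ y ‖

  IsCauchy : (ℕ → Carrierᴹ) → Set
  IsCauchy x = ∀ ε → 0ᴿ <ᴿ ε →
    Σ[ N ∈ ℕ ] ∀ m n → N ℕ.≤ m → N ℕ.≤ n → ‖ x m -ᴹ x n ‖ <ᴿ ε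

  _ConvergesTo_ : (ℕ → Carrierᴹ) → Carrierᴹ → Set
  x ConvergesTo y = ∀ ε → 0ᴿ <ᴿ ε → Eventually λ n → ‖ x n -ᴹ y ‖ <ᴿ ε

  field
    complete : ∀ x → IsCauchy x → ∃ λ y → x ConvergesTo y

  -- A countable dense subset is given by an enumeration; this loses nothing
  -- for finite subsets, since a dense subset is inhabited.
  Separable : Set c
  Separable = Σ[ d ∈ (ℕ → Carrierᴹ) ] ∀ x ε → 0ᴿ <ᴿ ε → ∃ λ n → ‖ x -ᴹ d n ‖ <ᴿ ε

  -- No congruence of f with respect to _≈ᴹ_ is required: it follows from the inequality.
  IsContraction : ℝ → (Carrierᴹ → Carrierᴹ) → Set c
  IsContraction k f = ∀ x y → ‖ f x -ᴹ f y ‖ ≤ᴿ k *ᴿ ‖ x -ᴹ y ‖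

  -- A ball is the pair of its centre and radius, compared by _≈ᴮ_, rather
  -- than the set of its points.
  record Ball : Set c where
    constructor [_,_]⟨_⟩
    field
      centre   : Carrierᴹ
      radius   : ℝ
      0≤radius : 0ᴿ ≤ᴿ radius

  open Ball public

  infix 4 _≈ᴮ_

  _≈ᴮ_ : Rel Ball ℓ
  B ≈ᴮ B′ = centre B ≈ᴹ centre B′ × radius B ≈ᴿ radius B′

  [_,0] : Carrierᴹ → Ball
  [ x ,0] = [ x , 0ᴿ ]⟨ ≤ᴿ-refl ⟩

  ballMap : (Carrierᴹ → Carrierᴹ) → (k : ℝ) → 0ᴿ ≤ᴿ k → Ball → Ball
  ballMap f k 0≤k B = [ f (centre B) , k *ᴿ radius B ]⟨ 0≤x*y 0≤k (0≤radius B) ⟩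

{-# OPTIONS --safe #-}
-- The ball component [x, r] ↦ [f x, k r] is the product of f with r ↦ k r, so the fixed
-- point is (x*, 0) with x* given by Banach's theorem.  Every estimate is made with rational
-- bounds: some rational q < 1 bounds k, a bound p of a distance becomes q p after
-- one application of f, and q ^ n * p → 0 by Bernoulli's inequality.
module Submission where

open import Defs
open import Data.Product using (∃; ∃!; _×_)
open import Function.Endo.Propositional using (_^_)

open import Algebra.Bundles using (CommutativeRing)
import Algebra.Definitions.RawSemiring as RawSemiringDefinitions
import Algebra.Properties.AbelianGroup as AbelianGroupProperties
open import Data.Integer.Base as ℤ using (+_)
import Data.Integer.Properties as ℤ
open import Data.Nat.Base as ℕ using (ℕ; zero; suc; z≤n; s≤s; _⊔_)
import Data.Nat.Properties as ℕ
open import Data.Product using (Σ-syntax; _,_; proj₁; proj₂)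
open import Data.Rational.Base as ℚ
  using (ℚ; 0ℚ; 1ℚ; ½; _+_; _*_; -_; _-_; _<_; _≤_; ∣_∣; toℚᵘ; mkℚ)
import Data.Rational.Properties as ℚ
open import Data.Rational.Solver using (module +-*-Solver)
open import Data.Rational.Unnormalised.Base as ℚᵘ using (mkℚᵘ; *≡*; *≤*)
import Data.Rational.Unnormalised.Properties as ℚᵘ
open import Data.Sum.Base using (inj₁; inj₂)
open import Relation.Binary.Lattice.Structures using (IsLattice)
open import Relation.Binary.PropositionalEquality
  using (_≡_; refl; sym; trans; cong; subst; subst₂)

open +-*-Solver using (solve; _:=_; _:+_; _:*_; :-_; _:-_; con)
open ℚ-Lemmas
open CauchyLemmas
open RawSemiringDefinitions ℚ.+-*-rawSemiring using () renaming (_×_ to _·_; _^_ to _^ℚ_)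

-- Rational arithmetic: the Archimedean property and vanishing powers.

toℚᵘ-·1 : ∀ n → toℚᵘ (n · 1ℚ) ℚᵘ.≃ mkℚᵘ (+ n) 0
toℚᵘ-·1 zero    = ℚᵘ.≃-refl
toℚᵘ-·1 (suc n) = begin
  toℚᵘ (1ℚ + n · 1ℚ)             ≈⟨ ℚ.toℚᵘ-homo-+ 1ℚ (n · 1ℚ) ⟩
  toℚᵘ 1ℚ ℚᵘ.+ toℚᵘ (n · 1ℚ)     ≈⟨ ℚᵘ.+-congʳ (toℚᵘ 1ℚ) (toℚᵘ-·1 n) ⟩
  toℚᵘ 1ℚ ℚᵘ.+ mkℚᵘ (+ n) 0      ≈⟨ *≡* (cong (λ z → (+ 1 ℤ.+ z) ℤ.* + 1) (ℤ.*-identityʳ (+ n))) ⟩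
  mkℚᵘ (+ suc n) 0               ∎
  where open ℚᵘ.≃-Reasoning

-- The absolute value of the numerator serves as threshold, because the denominator is at least 1.
-- The comparison is made in unnormalised rationals, where it is an inequality of integers.
archimedean : ∀ p → Eventually λ n → p ≤ n · 1ℚ
archimedean p@(mkℚ a d _) = ℤ.∣ a ∣ , λ n ∣a∣≤n → ℚ.toℚᵘ-cancel-≤ (begin
  toℚᵘ p            ≤⟨ *≤* (numerators n ∣a∣≤n) ⟩
  mkℚᵘ (+ n) 0      ≃⟨ toℚᵘ-·1 n ⟨
  toℚᵘ (n · 1ℚ)     ∎)
  where
  open ℚᵘ.≤-Reasoning
  i≤∣i∣ : ∀ i → i ℤ.≤ + ℤ.∣ i ∣
  i≤∣i∣ (+ _)        = ℤ.≤-refl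
  i≤∣i∣ (ℤ.-[1+ _ ]) = ℤ.-≤+
  numerators : ∀ n → ℤ.∣ a ∣ ℕ.≤ n → a ℤ.* + 1 ℤ.≤ + n ℤ.* + suc d
  numerators n ∣a∣≤n = ℤ.≤-trans (ℤ.≤-reflexive (ℤ.*-identityʳ a))
    (ℤ.≤-trans (i≤∣i∣ a)
      (ℤ.≤-trans (ℤ.+≤+ (ℕ.≤-trans ∣a∣≤n (ℕ.m≤m*n n (suc d))))
        (ℤ.≤-reflexive (ℤ.pos-* n (suc d)))))

*-nonNeg : ∀ {p q} → 0ℚ ≤ p → 0ℚ ≤ q → 0ℚ ≤ p * q
*-nonNeg {p} {q} 0≤p 0≤q =
  subst (_≤ p * q) (ℚ.*-zeroˡ q) (ℚ.*-monoʳ-≤-nonNeg q {{ℚ.nonNegative 0≤q}} 0≤p)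

p<p+q : ∀ {p q} → 0ℚ < q → p < p + q
p<p+q {p} {q} 0<q = subst (_< p + q) (ℚ.+-identityʳ p) (ℚ.+-monoʳ-< p 0<q)

p≤q+p : ∀ {p q} → 0ℚ ≤ q → p ≤ q + p
p≤q+p {p} {q} 0≤q = subst (_≤ q + p) (ℚ.+-identityˡ p) (ℚ.+-monoˡ-≤ p 0≤q)

p≤p+q : ∀ {p q} → 0ℚ ≤ q → p ≤ p + q
p≤p+q {p} {q} 0≤q = subst (_≤ p + q) (ℚ.+-identityʳ p) (ℚ.+-monoʳ-≤ p 0≤q)

p<q⇒0<q-p : ∀ {p q} → p < q → 0ℚ < q - p
p<q⇒0<q-p {p} {q} p<q = subst (_< q - p) (ℚ.+-inverseʳ p) (ℚ.+-monoˡ-< (- p) p<q)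

·1-nonNeg : ∀ n → 0ℚ ≤ n · 1ℚ
·1-nonNeg zero    = ℚ.≤-refl
·1-nonNeg (suc n) = ℚ.≤-trans (·1-nonNeg n) (p≤q+p (ℚ.nonNegative⁻¹ 1ℚ))

module Powers {q} (0≤q : 0ℚ ≤ q) where

  ^ℚ-nonNeg : ∀ n → 0ℚ ≤ q ^ℚ n
  ^ℚ-nonNeg zero    = ℚ.nonNegative⁻¹ 1ℚ
  ^ℚ-nonNeg (suc n) = *-nonNeg 0≤q (^ℚ-nonNeg n)

  -- Bernoulli's inequality for 1 / q; it holds for q > 1 too, where 1 - q < 0.
  bernoulli : ∀ n → q ^ℚ n * (1ℚ + n · 1ℚ * (1ℚ - q)) ≤ 1ℚ
  bernoulli zero    = ℚ.≤-reflexive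
    (solve 1 (λ h → con 1ℚ :* (con 1ℚ :+ con 0ℚ :* h) := con 1ℚ) refl (1ℚ - q))
  bernoulli (suc n) = begin
    q * q ^ℚ n * (1ℚ + (1ℚ + m) * h)
      -- With `q = 1 - h`, the product `q * (1 + (1 + m) * h)` falls short of `1 + m * h` by exactly
      -- `(1 + m) * h²`; this nonnegative term is added.
      ≤⟨ p≤p+q (*-nonNeg (^ℚ-nonNeg n) (*-nonNeg (·1-nonNeg (suc n)) 0≤h²)) ⟩
    q * q ^ℚ n * (1ℚ + (1ℚ + m) * h) + q ^ℚ n * ((1ℚ + m) * (h * h))
      ≡⟨ solve 3 (λ q a m → let h = con 1ℚ :- q in
           q :* a :* (con 1ℚ :+ (con 1ℚ :+ m) :* h) :+ a :* ((con 1ℚ :+ m) :* (h :* h))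
             := a :* (con 1ℚ :+ m :* h)) refl q (q ^ℚ n) m ⟩
    q ^ℚ n * (1ℚ + m * h)
      ≤⟨ bernoulli n ⟩
    1ℚ ∎
    where
    open ℚ.≤-Reasoning
    m = n · 1ℚ
    h = 1ℚ - q
    0≤h² : 0ℚ ≤ h * h
    0≤h² with ℚ.≤-total 0ℚ h
    ... | inj₁ 0≤h = *-nonNeg 0≤h 0≤h
    ... | inj₂ h≤0 = subst (0ℚ ≤_) (solve 1 (λ h → (:- h) :* (:- h) := h :* h) refl h)
                       (*-nonNeg (ℚ.neg-antimono-≤ h≤0) (ℚ.neg-antimono-≤ h≤0))

  ^ℚ-small : q < 1ℚ → ∀ {R ε} → 0ℚ < R → 0ℚ < ε → Eventually λ n → q ^ℚ n * R ≤ ε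
  ^ℚ-small q<1 {R} {ε} 0<R 0<ε =
    -- `δ` is `R / (h * ε)`, so `n ≥ δ` gives `R ≤ h * ε * n`.
    let δ , _ , hεδ≡R = quotient {R} {h * ε} 0<R (pos*pos 0<h 0<ε)
        N , large     = archimedean δ
    in N , λ n N≤n → begin
      q ^ℚ n * R
        ≡⟨ cong (q ^ℚ n *_) (sym hεδ≡R) ⟩
      q ^ℚ n * (h * ε * δ)
        ≤⟨ ℚ.*-monoˡ-≤-nonNeg (q ^ℚ n) {{ℚ.nonNegative (^ℚ-nonNeg n)}}
             (ℚ.*-monoˡ-≤-nonNeg (h * ε) {{ℚ.nonNegative (ℚ.<⇒≤ (pos*pos 0<h 0<ε))}}
               (large n N≤n)) ⟩
      q ^ℚ n * (h * ε * n · 1ℚ)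
        -- The extra `q ^ n * ε` completes the Bernoulli factor `1 + n * h`.
        ≤⟨ p≤p+q (*-nonNeg (^ℚ-nonNeg n) (ℚ.<⇒≤ 0<ε)) ⟩
      q ^ℚ n * (h * ε * n · 1ℚ) + q ^ℚ n * ε
        ≡⟨ solve 4 (λ a h ε m → a :* (h :* ε :* m) :+ a :* ε
             := a :* (con 1ℚ :+ m :* h) :* ε) refl (q ^ℚ n) h ε (n · 1ℚ) ⟩
      q ^ℚ n * (1ℚ + n · 1ℚ * h) * ε
        ≤⟨ ℚ.*-monoʳ-≤-nonNeg ε {{ℚ.nonNegative (ℚ.<⇒≤ 0<ε)}} (bernoulli n) ⟩
      1ℚ * ε
        ≡⟨ ℚ.*-identityˡ ε ⟩
      ε ∎
    where
    open ℚ.≤-Reasoning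
    h = 1ℚ - q
    0<h = p<q⇒0<q-p q<1

-- Order on the reals and comparison with rationals.

module ℝ-Ring = CommutativeRing ℝ-commutativeRing

fromℚ : ℚ → ℝ
fromℚ p = mkℝ (λ _ → p) (const-cauchy p)

pointwise-≤ : ∀ {x y} → (∀ n → seq x n ≤ seq y n) → x ≤ᴿ y
pointwise-≤ x≤y = mk≤ λ ε 0<ε → 0 , λ n _ → ℚ.≤-<-trans (x≤y n) (p<p+q 0<ε)

≤ᴿ-trans : ∀ {x y z} → x ≤ᴿ y → y ≤ᴿ z → x ≤ᴿ z
≤ᴿ-trans {x} {y} {z} (mk≤ p) (mk≤ q) = mk≤ λ ε 0<ε →
  map₂-ev (λ n a b → ℚ.<-trans a
      (subst (seq y n + ε * ½ <_)
        (trans (ℚ.+-assoc (seq z n) (ε * ½) (ε * ½)) (cong (_+_ (seq z n)) (half+half ε)))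
        (ℚ.+-monoˡ-< (ε * ½) b)))
    (p (ε * ½) (half⁺ 0<ε)) (q (ε * ½) (half⁺ 0<ε))

≈ᴿ⇒≤ᴿ : ∀ {x y} → x ≈ᴿ y → x ≤ᴿ y
≈ᴿ⇒≤ᴿ {x} {y} (mk≈ p) = mk≤ λ ε 0<ε → let N , P = p ε 0<ε in N , λ n N≤n →
  subst (_< seq y n + ε) (solve 2 (λ x y → y :+ (x :- y) := x) refl (seq x n) (seq y n))
    (ℚ.+-monoʳ-< (seq y n) (ℚ.≤-<-trans (p≤∣p∣ (seq x n - seq y n)) (P n N≤n)))

≤ᴿ-antisym : ∀ {x y} → x ≤ᴿ y → y ≤ᴿ x → x ≈ᴿ y
≤ᴿ-antisym {x} {y} (mk≤ p) (mk≤ q) = mk≈ λ ε 0<ε →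
  map₂-ev (λ n → ∣-∣< {seq x n} {seq y n}) (p ε 0<ε) (q ε 0<ε)
  where
  p<q+ε⇒p-q<ε : ∀ {p q ε} → p < q + ε → p - q < ε
  p<q+ε⇒p-q<ε {p} {q} {ε} p<q+ε = subst (p - q <_)
    (solve 2 (λ q ε → q :+ ε :- q := ε) refl q ε) (ℚ.+-monoˡ-< (- q) p<q+ε)
  ∣-∣< : ∀ {p q ε} → p < q + ε → q < p + ε → ∣ p - q ∣ < ε
  ∣-∣< {p} {q} {ε} p<q+ε q<p+ε with ℚ.∣p∣≡p∨∣p∣≡-p (p - q)
  ... | inj₁ eq = subst (_< ε) (sym eq) (p<q+ε⇒p-q<ε {p} p<q+ε)
  ... | inj₂ eq = subst (_< ε)
    (sym (trans eq (solve 2 (λ p q → :- (p :- q) := q :- p) refl p q))) (p<q+ε⇒p-q<ε {q} q<p+ε)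

+ᴿ-mono-≤ : ∀ {x y u v} → x ≤ᴿ y → u ≤ᴿ v → x +ᴿ u ≤ᴿ y +ᴿ v
+ᴿ-mono-≤ {x} {y} {u} {v} (mk≤ p) (mk≤ q) = mk≤ λ ε 0<ε →
  map₂-ev (λ n a b → subst (seq x n + seq u n <_)
      (trans (solve 3 (λ y v e → (y :+ e) :+ (v :+ e) := (y :+ v) :+ (e :+ e)) refl
                (seq y n) (seq v n) (ε * ½))
             (cong (_+_ (seq y n + seq v n)) (half+half ε)))
      (ℚ.+-mono-< a b))
    (p (ε * ½) (half⁺ 0<ε)) (q (ε * ½) (half⁺ 0<ε))

x≤y⇒0≤y-x : ∀ {x y} → x ≤ᴿ y → 0ᴿ ≤ᴿ y +ᴿ -ᴿ x
x≤y⇒0≤y-x {x} {y} x≤y = ≤ᴿ-trans (≈ᴿ⇒≤ᴿ (ℝ-Ring.sym (ℝ-Ring.-‿inverseʳ x)))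
  (+ᴿ-mono-≤ x≤y ≤ᴿ-refl)

-- The product of the nonnegative reals `u` and `y - x` is nonnegative; adding `u * x` gives the
-- claim.
*ᴿ-monoʳ-≤ : ∀ {u x y} → 0ᴿ ≤ᴿ u → x ≤ᴿ y → u *ᴿ x ≤ᴿ u *ᴿ y
*ᴿ-monoʳ-≤ {u} {x} {y} 0≤u x≤y = ≤ᴿ-trans
  (pointwise-≤ λ n → ℚ.≤-reflexive (sym (ℚ.+-identityˡ (seq u n * seq x n))))
  (≤ᴿ-trans (+ᴿ-mono-≤ (0≤x*y 0≤u (x≤y⇒0≤y-x x≤y)) (≤ᴿ-refl {u *ᴿ x}))
    (pointwise-≤ λ n → ℚ.≤-reflexive
      (solve 3 (λ u x y → u :* (y :- x) :+ u :* x := u :* y) refl (seq u n) (seq x n) (seq y n))))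

-- The comparison passes through `q * y`: the first factor is raised against `y ≥ 0`, then the
-- second against `q ≥ 0`.
*ᴿ-≤-fromℚ : ∀ {x y p q} → 0ᴿ ≤ᴿ y → 0ℚ ≤ q → x ≤ᴿ fromℚ q → y ≤ᴿ fromℚ p →
             x *ᴿ y ≤ᴿ fromℚ (q * p)
*ᴿ-≤-fromℚ {x} {y} {p} {q} 0≤y 0≤q x≤q y≤p =
  ≤ᴿ-trans (≈ᴿ⇒≤ᴿ (ℝ-Ring.*-comm x y))
    (≤ᴿ-trans (*ᴿ-monoʳ-≤ 0≤y x≤q)
      (≤ᴿ-trans (≈ᴿ⇒≤ᴿ (ℝ-Ring.*-comm y (fromℚ q)))
        (≤ᴿ-trans (*ᴿ-monoʳ-≤ (pointwise-≤ λ _ → 0≤q) y≤p) (pointwise-≤ λ _ → ℚ.≤-refl))))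

rational-bound : ∀ x → Σ[ B ∈ ℚ ] 0ℚ < B × x ≤ᴿ fromℚ B
rational-bound x = let B , 0<B , N , ∣x∣<B = bounded (cauchy x) in
  B , 0<B , mk≤ λ ε 0<ε → N , λ n N≤n →
    ℚ.<-trans (ℚ.≤-<-trans (p≤∣p∣ (seq x n)) (∣x∣<B n N≤n)) (p<p+q 0<ε)

≤-all-positive⇒≤0 : ∀ {x} → (∀ ε → 0ℚ < ε → x ≤ᴿ fromℚ ε) → x ≤ᴿ 0ᴿ
≤-all-positive⇒≤0 {x} x≤ = mk≤ λ ε 0<ε →
  -- One half of `ε` is the rational bound, the other the slack allowed by `_≤ᴿ_`.
  let mk≤ le = x≤ (ε * ½) (half⁺ 0<ε)
      N , P  = le (ε * ½) (half⁺ 0<ε)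
  in N , λ n N≤n → subst (seq x n <_) (trans (half+half ε) (sym (ℚ.+-identityˡ ε))) (P n N≤n)

fromℚ-pos : ∀ {p} → 0ℚ < p → 0ᴿ <ᴿ fromℚ p
fromℚ-pos {p} 0<p = mk< (p * ½ , half⁺ 0<p , 0 , λ _ _ →
  subst₂ _<_ (sym (ℚ.+-identityˡ (p * ½))) (half+half p) (p<p+q (half⁺ 0<p)))

-- Turns a rational estimate into the strict real bound asked for by `IsCauchy` and `ConvergesTo`.
-- Of the gap `γ`, one quarter is `δ`, one quarter is the slack in `x ≤ᴿ fromℚ δ`, and the remaining
-- half witnesses `x <ᴿ ε`.
rational-below : ∀ {ε} → 0ᴿ <ᴿ ε → Σ[ δ ∈ ℚ ] 0ℚ < δ × (∀ {x} → x ≤ᴿ fromℚ δ → x <ᴿ ε)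
rational-below {ε} (mk< (γ , 0<γ , ε>γ)) = γ * ½ * ½ , half⁺ (half⁺ 0<γ) , λ {x} (mk≤ le) →
  mk< (γ * ½ , half⁺ 0<γ , map₂-ev (λ n x< γ<ε → ℚ.<-trans
      (subst (seq x n + γ * ½ <_)
        (trans (cong (_+ γ * ½) (half+half (γ * ½)))
          (trans (half+half γ) (sym (ℚ.+-identityˡ γ))))
        (ℚ.+-monoˡ-< (γ * ½) x<))
      γ<ε)
    (le (γ * ½ * ½) (half⁺ (half⁺ 0<γ))) ε>γ)

-- `q` is 1 minus the gap that witnesses `k <ᴿ 1ᴿ`. It is nonnegative because at the index `M ⊔ N`,
-- past both thresholds, the approximation of `k` lies strictly between 0 and `q`.
rational-between : ∀ {k} → 0ᴿ <ᴿ k → k <ᴿ 1ᴿ →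
                   Σ[ q ∈ ℚ ] 0ℚ ≤ q × q < 1ℚ × k ≤ᴿ fromℚ q
rational-between {k} (mk< (δ , 0<δ , M , k>δ)) (mk< (ε , 0<ε , N , k<1-ε)) =
  1ℚ - ε , 0≤q , q<1 , mk≤ λ η 0<η → N , λ n N≤n → ℚ.<-trans (k<q n N≤n) (p<p+q 0<η)
  where
  k<q : ∀ n → N ℕ.≤ n → seq k n < 1ℚ - ε
  k<q n N≤n = subst (_< 1ℚ - ε) (solve 2 (λ k ε → k :+ ε :- ε := k) refl (seq k n) ε)
    (ℚ.+-monoˡ-< (- ε) (k<1-ε n N≤n))
  0<k : 0ℚ < seq k (M ⊔ N)
  0<k = ℚ.<-trans (p<p+q 0<δ) (k>δ (M ⊔ N) (ℕ.m≤m⊔n M N))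
  0≤q : 0ℚ ≤ 1ℚ - ε
  0≤q = ℚ.<⇒≤ (ℚ.<-trans 0<k (k<q (M ⊔ N) (ℕ.m≤n⊔m M N)))
  q<1 : 1ℚ - ε < 1ℚ
  q<1 = subst (1ℚ - ε <_) (solve 1 (λ ε → con 1ℚ :- ε :+ ε := con 1ℚ) refl ε) (p<p+q 0<ε)

-- Starting from some rational bound `B`, repeated improvement gives `x ≤ q ^ n * B` for every `n`.
-- This serves the uniqueness of both the centre and the radius.
self-improving⇒≈0 : ∀ {q x} → 0ℚ ≤ q → q < 1ℚ → 0ᴿ ≤ᴿ x →
                    (∀ p → x ≤ᴿ fromℚ p → x ≤ᴿ fromℚ (q * p)) → x ≈ᴿ 0ᴿ
self-improving⇒≈0 {q} {x} 0≤q q<1 0≤x improve =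
  ≤ᴿ-antisym (≤-all-positive⇒≤0 λ ε 0<ε →
    let N , small = ^ℚ-small q<1 0<B 0<ε in
    ≤ᴿ-trans (iterated N) (pointwise-≤ λ _ → small N ℕ.≤-refl)) 0≤x
  where
  open Powers 0≤q
  B   = proj₁ (rational-bound x)
  0<B = proj₁ (proj₂ (rational-bound x))
  iterated : ∀ n → x ≤ᴿ fromℚ (q ^ℚ n * B)
  iterated zero    = subst (λ p → x ≤ᴿ fromℚ p) (sym (ℚ.*-identityˡ B))
                       (proj₂ (proj₂ (rational-bound x)))
  iterated (suc n) = subst (λ p → x ≤ᴿ fromℚ p) (sym (ℚ.*-assoc q (q ^ℚ n) B))
                       (improve (q ^ℚ n * B) (iterated n))

-- Rational bounds on distances in a Banach lattice.

module Distance {c ℓ ℓ₂} (X : BanachLattice c ℓ ℓ₂) where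
  open BanachLattice X
  open AbelianGroupProperties +ᴹ-abelianGroup
    using (⁻¹-anti-homo‿-; ⁻¹-involutive; x∙y⁻¹≈ε⇒x≈y; x≈y⇒x∙y⁻¹≈ε)
  open IsLattice isLattice using (x≤x∨y; y≤x∨y; ∨-least) renaming (≤-respˡ-≈ to ≤ᴹ-respˡ-≈)

  -- A record, so that the endpoints can be inferred.
  record Dist≤ (x y : Carrierᴹ) (p : ℚ) : Set where
    constructor mkDist≤
    field bound : ‖ x -ᴹ y ‖ ≤ᴿ fromℚ p
  open Dist≤ public

  dist-weaken : ∀ {x y p q} → p ≤ q → Dist≤ x y p → Dist≤ x y q
  dist-weaken p≤q (mkDist≤ d) = mkDist≤ (≤ᴿ-trans d (pointwise-≤ λ _ → p≤q))

  -- The norm is monotone in the modulus, and `x ∨ (-ᴹ x)` is an upper bound of both `-ᴹ x` and its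
  -- negative.
  ‖-x‖≤‖x‖ : ∀ x → ‖ -ᴹ x ‖ ≤ᴿ ‖ x ‖
  ‖-x‖≤‖x‖ x = ‖‖-mono (∨-least (y≤x∨y x (-ᴹ x))
    (≤ᴹ-respˡ-≈ (≈ᴹ-sym (⁻¹-involutive x)) (x≤x∨y x (-ᴹ x))))

  dist-sym : ∀ {x y p} → Dist≤ x y p → Dist≤ y x p
  dist-sym {x} {y} (mkDist≤ d) = mkDist≤ (≤ᴿ-trans
    (≈ᴿ⇒≤ᴿ (‖‖-cong (≈ᴹ-sym (⁻¹-anti-homo‿- x y)))) (≤ᴿ-trans (‖-x‖≤‖x‖ (x -ᴹ y)) d))

  [x-y]+[y-z]≈x-z : ∀ x y z → (x -ᴹ y) +ᴹ (y -ᴹ z) ≈ᴹ x -ᴹ z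
  [x-y]+[y-z]≈x-z x y z = ≈ᴹ-trans (+ᴹ-assoc x (-ᴹ y) (y -ᴹ z)) (+ᴹ-congˡ
    (≈ᴹ-trans (≈ᴹ-sym (+ᴹ-assoc (-ᴹ y) y (-ᴹ z)))
      (≈ᴹ-trans (+ᴹ-congʳ (-ᴹ‿inverseˡ y)) (+ᴹ-identityˡ (-ᴹ z)))))

  dist-triangle : ∀ {x y z p q} → Dist≤ x y p → Dist≤ y z q → Dist≤ x z (p + q)
  dist-triangle {x} {y} {z} (mkDist≤ d) (mkDist≤ e) = mkDist≤
    (≤ᴿ-trans (≈ᴿ⇒≤ᴿ (‖‖-cong (≈ᴹ-sym ([x-y]+[y-z]≈x-z x y z))))
      (≤ᴿ-trans (‖‖-triangle (x -ᴹ y) (y -ᴹ z))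
        (≤ᴿ-trans (+ᴿ-mono-≤ d e) (pointwise-≤ λ _ → ℚ.≤-refl))))

  -- The difference equals `0ᴿ *ₗ x`, whose norm vanishes by homogeneity.
  ≈⇒dist : ∀ {x y} → x ≈ᴹ y → Dist≤ x y 0ℚ
  ≈⇒dist {x} {y} x≈y = mkDist≤ (≤ᴿ-trans (≈ᴿ⇒≤ᴿ (ℝ-Ring.trans (‖‖-cong x-y≈0*x)
      (‖‖-homogeneous 0ᴿ x)))
    (pointwise-≤ λ n → ℚ.≤-reflexive (ℚ.*-zeroˡ (seq ‖ x ‖ n))))
    where
    x-y≈0*x : x -ᴹ y ≈ᴹ 0ᴿ *ₗ x
    x-y≈0*x = ≈ᴹ-trans (x≈y⇒x∙y⁻¹≈ε x≈y) (≈ᴹ-sym (*ₗ-zeroˡ x))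

  dist-bound : ∀ x y → Σ[ p ∈ ℚ ] 0ℚ < p × Dist≤ x y p
  dist-bound x y = let p , 0<p , d = rational-bound ‖ x -ᴹ y ‖ in p , 0<p , mkDist≤ d

  ‖x-y‖≈0⇒x≈y : ∀ {x y} → ‖ x -ᴹ y ‖ ≈ᴿ 0ᴿ → x ≈ᴹ y
  ‖x-y‖≈0⇒x≈y {x} {y} d = x∙y⁻¹≈ε⇒x≈y x y (‖‖-definite d)

  dist-all-positive⇒≈ : ∀ {x y} → (∀ ε → 0ℚ < ε → Dist≤ x y ε) → x ≈ᴹ y
  dist-all-positive⇒≈ d = ‖x-y‖≈0⇒x≈y
    (≤ᴿ-antisym (≤-all-positive⇒≤0 λ ε 0<ε → bound (d ε 0<ε)) (‖‖-nonNeg _))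

-- Picard iteration of a contraction.

module Picard {c ℓ ℓ₂} (X : BanachLattice c ℓ ℓ₂)
              (f : BanachLattice.Carrierᴹ X → BanachLattice.Carrierᴹ X) {k : ℝ}
              (contraction : BanachLattice.IsContraction X k f)
              {q : ℚ} (0≤q : 0ℚ ≤ q) (q<1 : q < 1ℚ) (k≤q : k ≤ᴿ fromℚ q) where
  open BanachLattice X
  open Distance X
  open Powers 0≤q

  iterate : ℕ → Carrierᴹ → Carrierᴹ
  iterate = _^_ Carrierᴹ f

  dist-f : ∀ {x y p} → Dist≤ x y p → Dist≤ (f x) (f y) (q * p)
  dist-f {x} {y} (mkDist≤ d) = mkDist≤
    (≤ᴿ-trans (contraction x y) (*ᴿ-≤-fromℚ (‖‖-nonNeg (x -ᴹ y)) 0≤q k≤q d))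

  -- The ball of radius `R` about `x` is mapped into itself: a point within `R` of `x` has image
  -- within `q * R` of `f x`, and `(1 - q) * R + q * R = R`. This stands in for summing a geometric
  -- series.
  orbit-within : ∀ {x R} → 0ℚ ≤ R → Dist≤ x (f x) ((1ℚ - q) * R) →
                 ∀ n → Dist≤ x (iterate n x) R
  orbit-within 0≤R d zero    = dist-weaken 0≤R (≈⇒dist ≈ᴹ-refl)
  orbit-within {x} {R} 0≤R d (suc n) = subst (Dist≤ x (iterate (suc n) x))
    (solve 2 (λ q R → (con 1ℚ :- q) :* R :+ q :* R := R) refl q R)
    (dist-triangle d (dist-f (orbit-within 0≤R d n)))

  orbit-bound : ∀ x → Σ[ R ∈ ℚ ] 0ℚ < R × (∀ n → Dist≤ x (iterate n x) R)
  orbit-bound x =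
    let p , 0<p , d    = dist-bound x (f x)
        -- `R` is `p / (1 - q)`, the sum of the geometric series with first term `p`.
        R , 0<R , hR≡p = quotient {p} {1ℚ - q} 0<p (p<q⇒0<q-p q<1)
    in R , 0<R , orbit-within (ℚ.<⇒≤ 0<R) (subst (Dist≤ x (f x)) (sym hR≡p) d)

  -- Both points are images under `m` applications of `f`, of `x` and of a later point of its orbit;
  -- each application contributes a factor `q`.
  orbit-tail : ∀ {x R} → (∀ n → Dist≤ x (iterate n x) R) →
               ∀ {m n} → m ℕ.≤ n → Dist≤ (iterate m x) (iterate n x) (q ^ℚ m * R)
  orbit-tail {x} {R} orbit {n = n} z≤n =
    subst (Dist≤ x (iterate n x)) (sym (ℚ.*-identityˡ R)) (orbit n)
  orbit-tail {R = R} orbit {suc m} (s≤s m≤n) =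
    subst (Dist≤ _ _) (sym (ℚ.*-assoc q (q ^ℚ m) R)) (dist-f (orbit-tail orbit m≤n))

  iterates-cauchy : ∀ x → IsCauchy (λ n → iterate n x)
  iterates-cauchy x ε 0<ε =
    let δ , 0<δ , below = rational-below 0<ε
        R , 0<R , orbit = orbit-bound x
        N , small       = ^ℚ-small q<1 0<R (half⁺ 0<δ)
        -- Both indices are compared with the single iterate at `N`.
        near : ∀ n → N ℕ.≤ n → Dist≤ (iterate N x) (iterate n x) (δ * ½)
        near n N≤n = dist-weaken (small N ℕ.≤-refl) (orbit-tail orbit N≤n)
    in N , λ m n N≤m N≤n → below (bound (subst (Dist≤ (iterate m x) (iterate n x)) (half+half δ)
         (dist-triangle (dist-sym (near m N≤m)) (near n N≤n))))

  limit : ∀ x → ∃ λ y → (λ n → iterate n x) ConvergesTo y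
  limit x = complete (λ n → iterate n x) (iterates-cauchy x)

  limit-fixed : ∀ {x y} → (λ n → iterate n x) ConvergesTo y → f y ≈ᴹ y
  limit-fixed {x} {y} converges = dist-all-positive⇒≈ λ ε 0<ε →
    let N , close  = converges (fromℚ (ε * ½)) (fromℚ-pos (half⁺ 0<ε))
        at : ∀ n → N ℕ.≤ n → Dist≤ (iterate n x) y (ε * ½)
        at n N≤n = mkDist≤ (<ᴿ⇒≤ᴿ (close n N≤n))
        qε/2≤ε/2 : q * (ε * ½) ≤ ε * ½
        qε/2≤ε/2 = subst (q * (ε * ½) ≤_) (ℚ.*-identityˡ (ε * ½))
          (ℚ.*-monoʳ-≤-nonNeg (ε * ½) {{ℚ.nonNegative (ℚ.<⇒≤ (half⁺ 0<ε))}} (ℚ.<⇒≤ q<1))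
    in subst (Dist≤ (f y) y) (half+half ε)
         -- The intermediate point is the iterate at `suc N`: as the image of the iterate at `N` it
         -- is near `f y`, and as a later iterate it is near `y`.
         (dist-triangle
           (dist-weaken qε/2≤ε/2 (dist-f (dist-sym (at N ℕ.≤-refl))))
           (at (suc N) (ℕ.n≤1+n N)))

  module _ {x* : Carrierᴹ} (fixed : f x* ≈ᴹ x*) where

    dist-f-fixed : ∀ {x p} → Dist≤ x x* p → Dist≤ (f x) x* (q * p)
    dist-f-fixed {x} {p} d = subst (Dist≤ (f x) x*) (ℚ.+-identityʳ (q * p))
      (dist-triangle (dist-f d) (≈⇒dist fixed))

    iterates-geometric : ∀ {x p} → Dist≤ x x* p → ∀ n → Dist≤ (iterate n x) x* (q ^ℚ n * p)
    iterates-geometric {x} {p} d zero    = subst (Dist≤ x x*) (sym (ℚ.*-identityˡ p)) d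
    iterates-geometric {x} {p} d (suc n) = subst (Dist≤ (iterate (suc n) x) x*)
      (sym (ℚ.*-assoc q (q ^ℚ n) p)) (dist-f-fixed (iterates-geometric d n))

    -- Distances to a fixed point shrink geometrically from any start, so every orbit has the same
    -- limit.
    iterates-converge : ∀ x → (λ n → iterate n x) ConvergesTo x*
    iterates-converge x ε 0<ε =
      let δ , 0<δ , below = rational-below 0<ε
          p , 0<p , d     = dist-bound x x*
          N , small       = ^ℚ-small q<1 0<p 0<δ
      in N , λ n N≤n → below (bound (dist-weaken (small n N≤n) (iterates-geometric d n)))

    -- A bound `p` on the distance from `y` to `x*` improves to `q * p`, since `y` may be replaced
    -- by `f y`.
    fixed-unique : ∀ {y} → f y ≈ᴹ y → x* ≈ᴹ y
    fixed-unique {y} fy≈y = ≈ᴹ-sym (‖x-y‖≈0⇒x≈y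
      (self-improving⇒≈0 0≤q q<1 (‖‖-nonNeg (y -ᴹ x*)) λ p d →
        bound (subst (Dist≤ y x*) (ℚ.+-identityˡ (q * p))
          (dist-triangle (≈⇒dist (≈ᴹ-sym fy≈y)) (dist-f-fixed (mkDist≤ d))))))

  radius-unique : ∀ {r} → 0ᴿ ≤ᴿ r → k *ᴿ r ≈ᴿ r → r ≈ᴿ 0ᴿ
  radius-unique 0≤r kr≈r = self-improving⇒≈0 0≤q q<1 0≤r λ p r≤p →
    ≤ᴿ-trans (≈ᴿ⇒≤ᴿ (ℝ-Ring.sym kr≈r)) (*ᴿ-≤-fromℚ 0≤r 0≤q k≤q r≤p)

-- Assembly of the fixed ball from its centre and radius.

theorem3p4 : ∀ {c ℓ ℓ₂} (X : BanachLattice c ℓ ℓ₂) →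
    let
      open BanachLattice X
    in
    Separable →
    (f : Carrierᴹ → Carrierᴹ) (k : ℝ) (0<k : 0ᴿ <ᴿ k) → k <ᴿ 1ᴿ →
    IsContraction k f →
    let T = ballMap f k (<ᴿ⇒≤ᴿ 0<k) in
    ∃! _≈ᴮ_ (λ B → T B ≈ᴮ B) ×
    ∃ (λ x* → T [ x* ,0] ≈ᴮ [ x* ,0] × (∀ x → (λ n → _^_ Carrierᴹ f n x) ConvergesTo x*))
theorem3p4 X separable f k 0<k k<1 contraction =
  ([ x* ,0] , fixed , λ {B} (fy≈y , kr≈r) →
    fixed-unique (proj₁ fixed) fy≈y , ℝ-Ring.sym (radius-unique (0≤radius B) kr≈r)) ,
  x* , fixed , iterates-converge (proj₁ fixed)
  where
  open BanachLattice X
  q-spec = rational-between 0<k k<1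
  open Picard X f contraction (proj₁ (proj₂ q-spec)) (proj₁ (proj₂ (proj₂ q-spec)))
    (proj₂ (proj₂ (proj₂ q-spec)))
  -- The orbit of `0ᴹ` supplies the centre; the orbits of other points are handled by
  -- `iterates-converge`.
  x* = proj₁ (limit 0ᴹ)
  fixed : ballMap f k (<ᴿ⇒≤ᴿ 0<k) [ x* ,0] ≈ᴮ [ x* ,0]
  fixed = limit-fixed (proj₂ (limit 0ᴹ)) , ℝ-Ring.zeroʳ k
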